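{- Let $H$ be a connected graph of order $a \in \mathbb{N}$. Then for every $b \in \mathbb{N}$, \[1 + (a-1)(b-2) \le R_\mathrm{cyc}(H, P_b^\mathrm{mon}) \le 1 + (a-1)(b-1).\]
   Context: All graphs are finite, simple and undirected, and a graph of order $n$ has vertex set $\{0,1,\ldots,n-1\}$; $K_n$ is the complete graph on $\{0,\ldots,n-1\}$. A $2$-edge-coloring of $K_n$ assigns each edge a color in $\{1,2\}$. For a graph $H$ and such a coloring, an embedding of $H$ in color $j$ is an injective map $\varphi\colon V(H)\to V(K_n)$ such that for every edge $uv$ of $H$ the edge $\{\varphi(u),\varphi(v)\}$ has color $j$; it is increasing up to a cyclic permutation if there exists $t\in V(H)$ such that $(\varphi(t),\varphi(t+1),\ldots,\varphi(|H|-1),\varphi(0),\varphi(1),\ldots,\varphi(t-1))$ is an increasing sequence. The cyclic Ramsey number $R_\mathrm{cyc}(H_1,H_2)$ is the smallest $n\in\mathbb{N}$ such that every $2$-edge-coloring of $K_n$ admits an embedding of $H_1$ in color $1$ or of $H_2$ in color $2$ that is increasing up to a cyclic permutation. The monotone path $P_n^\mathrm{mon}$ is the graph of order $n$ in which two vertices are adjacent iff they are consecutive integers. -}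

module Defs where

open import Data.Fin.Base using (Fin; toℕ) renaming (_<_ to _<ᶠ_)
open import Data.List.Base using (List; _++_; drop; take; tabulate)
open import Data.List.Relation.Unary.Linked using (Linked)
open import Data.Nat.Base using (ℕ; suc; _≤_)
open import Data.Nat.Properties using (_≟_; 1+n≢n)
open import Data.Product.Base using (Σ-syntax; ∃-syntax; _×_)
open import Data.Sum.Base using (_⊎_; [_,_]; swap)
open import Function.Definitions using (Injective)
open import Relation.Binary.Construct.Closure.ReflexiveTransitive using (Star)
open import Relation.Binary.Core using (Rel)
open import Relation.Binary.Definitions using (Decidable; Symmetric)
open import Relation.Binary.PropositionalEquality.Core using (_≡_)
open import Relation.Nullary.Decidable.Core using (_⊎-dec_)
open import Relation.Nullary.Negation.Core using (¬_)
open import Level using (0ℓ)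

-- Adjacency is decidable so that the graph is a finite object in the
-- classical sense.
record Graph (n : ℕ) : Set₁ where
  field
    Adj    : Rel (Fin n) 0ℓ
    adj?   : Decidable Adj
    sym    : Symmetric Adj
    irrefl : ∀ {u} → ¬ Adj u u

open Graph public using (Adj)

-- Any two vertices are joined by a walk.  This holds vacuously at order 0.
Connected : ∀ {n} → Graph n → Set
Connected H = ∀ u v → Star (Adj H) u v

Pmon : ∀ n → Graph n
Pmon n = record
  { Adj    = λ i j → suc (toℕ i) ≡ toℕ j ⊎ suc (toℕ j) ≡ toℕ i
  ; adj?   = λ i j → (suc (toℕ i) ≟ toℕ j) ⊎-dec (suc (toℕ j) ≟ toℕ i)
  ; sym    = swap
  ; irrefl = [ 1+n≢n , 1+n≢n ]
  }

data Color : Set where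
  color₁ color₂ : Color

-- A 2-edge-coloring of K_n as a symmetric function.  The diagonal values
-- carry no meaning: embeddings are injective and graphs are loopless, so
-- they are never consulted.
record Coloring (n : ℕ) : Set where
  field
    color     : Fin n → Fin n → Color
    color-sym : ∀ u v → color u v ≡ color v u

open Coloring public using (color)

IsEmbedding : ∀ {h n} → Graph h → Coloring n → Color → (Fin h → Fin n) → Set
IsEmbedding H χ j φ =
  Injective _≡_ _≡_ φ × (∀ {u v} → Adj H u v → color χ (φ u) (φ v) ≡ j)

-- The list φ(t), …, φ(h-1), φ(0), …, φ(t-1).
rotated : ∀ {h n} → (Fin h → Fin n) → Fin h → List (Fin n)
rotated φ t = drop (toℕ t) (tabulate φ) ++ take (toℕ t) (tabulate φ)

CyclicallyIncreasing : ∀ {h n} → (Fin h → Fin n) → Set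
CyclicallyIncreasing {h} φ = Σ[ t ∈ Fin h ] Linked _<ᶠ_ (rotated φ t)

HasCyclicEmbedding : ∀ {h n} → Graph h → Coloring n → Color → Set
HasCyclicEmbedding H χ j = ∃[ φ ] (IsEmbedding H χ j φ × CyclicallyIncreasing φ)

CyclicArrow : ∀ {h₁ h₂} → Graph h₁ → Graph h₂ → ℕ → Set
CyclicArrow H₁ H₂ n = (χ : Coloring n) →
  HasCyclicEmbedding H₁ χ color₁ ⊎ HasCyclicEmbedding H₂ χ color₂

-- R = R_cyc(H₁, H₂).  Letting n range over 0 as well is harmless:
-- CyclicArrow H₁ H₂ 0 is always false, since CyclicallyIncreasing φ provides
-- a vertex t and hence an element φ t of Fin 0.
IsRcyc : ∀ {h₁ h₂} → Graph h₁ → Graph h₂ → ℕ → Set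
IsRcyc H₁ H₂ R = CyclicArrow H₁ H₂ R × (∀ n → CyclicArrow H₁ H₂ n → R ≤ n)

{-# OPTIONS --safe #-}

-- Upper bound: among the vertices remaining, those without a smaller neighbour
-- in color 2 form a clique in color 1.  Either it has a vertices, and H embeds,
-- or it has at most a - 1; deleting it and repeating b - 1 times leaves a
-- vertex, from which an increasing path in color 2 can be traced back.
--
-- Lower bound: cut the vertices into at most b - 2 intervals of a - 1 vertices,
-- with color 1 inside the intervals and color 2 between them.  A connected graph
-- in color 1 stays inside one interval.  A cyclically increasing path on b
-- vertices in color 2 moves to a later interval at each step but one, so it
-- meets at least b - 1 intervals.
--
-- The least R exists because the arrow relation is decidable.

module Submission where

open import Data.Fin.Base as Fin using (Fin; zero; suc; toℕ; combine; remQuot; finToFun; funToFin)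
import Data.Fin.Properties as Fin
open import Data.Integer.Base using (+_; _+_; _-_; _*_; _≤_; +≤+; -≤+)
import Data.Integer.Properties as ℤ
open import Data.List.Base using (List; []; _∷_; _++_; length; filter; take; drop; tabulate; lookup)
open import Data.List.Membership.Propositional using (_∈_; find; lose)
open import Data.List.Membership.Propositional.Properties using (∈-filter⁻; ∈-lookup)
open import Data.List.Properties
  using (++-identityʳ; length-++-comm; length-tabulate; length-take; tabulate-cong; take++drop≡id)
open import Data.List.Relation.Unary.All as All using (All; []; _∷_)
open import Data.List.Relation.Unary.AllPairs as AllPairs using (AllPairs; []; _∷_)
import Data.List.Relation.Unary.AllPairs.Properties as AllPairs
open import Data.List.Relation.Unary.Any using (Any; any?; here)
open import Data.List.Relation.Unary.Linked as Linked using (Linked; []; [-]; _∷_; linked?)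
open import Data.List.Relation.Unary.Linked.Properties using (AllPairs⇒Linked; Linked⇒AllPairs)
open import Data.Nat.Base as ℕ using (ℕ; zero; suc; z≤n; s≤s; NonZero)
open import Data.Nat.DivMod using (_/_; _%_; _mod_; m≡m%n+[m/n]*n; m<n*o⇒m/o<n; /-monoˡ-≤)
import Data.Nat.Properties as ℕ
open import Data.Product.Base using (∃; ∃-syntax; _×_; _,_; proj₁; proj₂)
open import Data.Sum.Base using (_⊎_; inj₁; inj₂)
open import Function.Base using (_∘_; _on_)
open import Function.Definitions using (Injective)
open import Level using (Level)
open import Relation.Binary.Construct.Closure.ReflexiveTransitive using (Star; ε; _◅_)
open import Relation.Binary.Core using (Rel)
import Relation.Binary.Definitions as B
open import Relation.Binary.Definitions using (tri<; tri≈; tri>)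
open import Relation.Binary.PropositionalEquality
open import Relation.Nullary.Decidable using (Dec; yes; no; map′; _×-dec_; _⊎-dec_; _→-dec_; ¬?)
open import Relation.Nullary.Negation using (¬_; contradiction)
open import Relation.Unary using (Pred; Decidable)
open import Defs

private
  variable
    ℓ ℓ′ : Level
    A : Set
    h h₁ h₂ m n : ℕ

-- Deciding the arrow relation

_≟ᶜ_ : B.DecidableEquality Color
color₁ ≟ᶜ color₁ = yes refl
color₁ ≟ᶜ color₂ = no λ ()
color₂ ≟ᶜ color₁ = no λ ()
color₂ ≟ᶜ color₂ = yes refl

≢color₂⇒≡color₁ : ∀ {c} → c ≢ color₂ → c ≡ color₁
≢color₂⇒≡color₁ {color₁} _   = refl
≢color₂⇒≡color₁ {color₂} c≢2 = contradiction refl c≢2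

-- A search upward from `0` that shifts the predicate at each step; the known member `n` bounds its
-- length.
least : {P : Pred ℕ ℓ} → Decidable P → ∀ n → P n → ∃[ m ] (P m × (∀ k → P k → m ℕ.≤ k))
least P? zero    p0 = zero , p0 , λ _ _ → z≤n
least P? (suc n) pn with P? zero
... | yes p0 = zero , p0 , λ _ _ → z≤n
... | no ¬p0 with least (P? ∘ suc) n pn
...   | m , pm , m-min = suc m , pm , λ where
          zero    p0 → contradiction p0 ¬p0
          (suc k) pk → s≤s (m-min k pk)

-- Functions between finite sets are enumerated through numerical codes, and decoding a code returns
-- the original function only pointwise.
Extensional : Pred (Fin m → A) ℓ → Set ℓ
Extensional P = ∀ {f g} → f ≗ g → P f → P g

anyFunction? : {P : Pred (Fin m → Fin n) ℓ} → Extensional P → Decidable P → Dec (∃ P)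
anyFunction? ext P? = map′
  (λ (i , p) → finToFun i , p)
  (λ (f , p) → funToFin f , ext (sym ∘ Fin.finToFun-funToFin f) p)
  (Fin.any? (P? ∘ finToFun))

allFunctions? : {P : Pred (Fin m → Fin n) ℓ} → Extensional P → Decidable P → Dec (∀ f → P f)
allFunctions? ext P? = map′
  (λ p f → ext (Fin.finToFun-funToFin f) (p (funToFin f)))
  (λ p → p ∘ finToFun)
  (Fin.all? (P? ∘ finToFun))

IsCyclicEmbedding : Graph h → Coloring n → Color → (Fin h → Fin n) → Set
IsCyclicEmbedding H χ c φ = IsEmbedding H χ c φ × CyclicallyIncreasing φ

isCyclicEmbedding-ext : (H : Graph h) (χ : Coloring n) (c : Color) →
  Extensional (IsCyclicEmbedding H χ c)
isCyclicEmbedding-ext H χ c f≗g ((inj , edges) , t , lnk) =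
  ( (λ {u} {v} gu≡gv → inj (trans (f≗g u) (trans gu≡gv (sym (f≗g v)))))
  , (λ {u} {v} uv → trans (sym (cong₂ (color χ) (f≗g u) (f≗g v))) (edges uv)))
  , t
  , subst (λ xs → Linked Fin._<_ (drop (toℕ t) xs ++ take (toℕ t) xs)) (tabulate-cong f≗g) lnk

isCyclicEmbedding? : (H : Graph h) (χ : Coloring n) (c : Color) →
  Decidable (IsCyclicEmbedding H χ c)
isCyclicEmbedding? H χ c φ = (injective? ×-dec edges?)
  ×-dec Fin.any? (λ t → linked? Fin._<?_ (rotated φ t))
  where
  injective? : Dec (Injective _≡_ _≡_ φ)
  injective? = map′ (λ p {u} {v} → p u v) (λ p u v → p)
    (Fin.all? λ u → Fin.all? λ v → (φ u Fin.≟ φ v) →-dec (u Fin.≟ v))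

  edges? : Dec (∀ {u v} → Adj H u v → color χ (φ u) (φ v) ≡ c)
  edges? = map′ (λ p {u} {v} → p u v) (λ p u v → p)
    (Fin.all? λ u → Fin.all? λ v → Graph.adj? H u v →-dec (color χ (φ u) (φ v) ≟ᶜ c))

hasCyclicEmbedding? : (H : Graph h) (χ : Coloring n) (c : Color) →
  Dec (HasCyclicEmbedding H χ c)
hasCyclicEmbedding? H χ c =
  anyFunction? (isCyclicEmbedding-ext H χ c) (isCyclicEmbedding? H χ c)

hasCyclicEmbedding-recolor : (H : Graph h) (χ χ′ : Coloring n) (c : Color) →
  (∀ u v → color χ u v ≡ color χ′ u v) →
  HasCyclicEmbedding H χ c → HasCyclicEmbedding H χ′ c
hasCyclicEmbedding-recolor H χ χ′ c χ≗χ′ (φ , (inj , edges) , inc) =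
  φ , (inj , λ uv → trans (sym (χ≗χ′ _ _)) (edges uv)) , inc

decodeColor : Fin 2 → Color
decodeColor zero    = color₁
decodeColor (suc _) = color₂

encodeColor : Color → Fin 2
encodeColor color₁ = zero
encodeColor color₂ = suc zero

decodeColor-encodeColor : ∀ c → decodeColor (encodeColor c) ≡ c
decodeColor-encodeColor color₁ = refl
decodeColor-encodeColor color₂ = refl

-- Commutativity makes a symmetrized function symmetric; idempotence makes symmetrization preserve a
-- function that is already symmetric.
_∧ᶜ_ : Color → Color → Color
color₁ ∧ᶜ d = d
color₂ ∧ᶜ d = color₂

∧ᶜ-comm : ∀ c d → c ∧ᶜ d ≡ d ∧ᶜ c
∧ᶜ-comm color₁ color₁ = refl
∧ᶜ-comm color₁ color₂ = refl
∧ᶜ-comm color₂ color₁ = refl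
∧ᶜ-comm color₂ color₂ = refl

∧ᶜ-idem : ∀ c → c ∧ᶜ c ≡ c
∧ᶜ-idem color₁ = refl
∧ᶜ-idem color₂ = refl

-- Symmetrization makes every function a coloring, so that colorings can be
-- enumerated as plain functions on pairs.
symmetrized : (Fin (n ℕ.* n) → Fin 2) → Coloring n
symmetrized f = record
  { color     = λ u v → at u v ∧ᶜ at v u
  ; color-sym = λ u v → ∧ᶜ-comm (at u v) (at v u)
  }
  where
  at : Fin _ → Fin _ → Color
  at u v = decodeColor (f (combine u v))

encodeColoring : Coloring n → Fin (n ℕ.* n) → Fin 2
encodeColoring {n} χ i = let u , v = remQuot n i in encodeColor (color χ u v)

symmetrized-encodeColoring : (χ : Coloring n) →
  ∀ u v → color (symmetrized (encodeColoring χ)) u v ≡ color χ u v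
symmetrized-encodeColoring {n} χ u v = begin
  at u v ∧ᶜ at v u            ≡⟨ cong₂ _∧ᶜ_ (at≡color u v) (at≡color v u) ⟩
  color χ u v ∧ᶜ color χ v u  ≡⟨ cong (color χ u v ∧ᶜ_) (Coloring.color-sym χ v u) ⟩
  color χ u v ∧ᶜ color χ u v  ≡⟨ ∧ᶜ-idem (color χ u v) ⟩
  color χ u v                 ∎
  where
  open ≡-Reasoning

  at : Fin n → Fin n → Color
  at u v = decodeColor (encodeColoring χ (combine u v))

  at≡color : ∀ u v → at u v ≡ color χ u v
  at≡color u v = trans (decodeColor-encodeColor _)
    (cong (λ (i , j) → color χ i j) (Fin.remQuot-combine {k = n} u v))

-- Every coloring agrees pointwise with the symmetrization of its code, and embeddings see only the
-- values of a coloring, so testing the finitely many codes suffices.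
cyclicArrow? : (H₁ : Graph h₁) (H₂ : Graph h₂) → Decidable (CyclicArrow H₁ H₂)
cyclicArrow? H₁ H₂ n = map′
  (λ p χ → recolor {symmetrized (encodeColoring χ)} {χ} (symmetrized-encodeColoring χ) (p (encodeColoring χ)))
  (λ p f → p (symmetrized f))
  (allFunctions? extensional
    λ f → hasCyclicEmbedding? H₁ (symmetrized f) color₁
      ⊎-dec hasCyclicEmbedding? H₂ (symmetrized f) color₂)
  where
  Good : Coloring n → Set
  Good χ = HasCyclicEmbedding H₁ χ color₁ ⊎ HasCyclicEmbedding H₂ χ color₂

  recolor : {χ χ′ : Coloring n} → (∀ u v → color χ u v ≡ color χ′ u v) → Good χ → Good χ′
  recolor {χ} {χ′} eq (inj₁ e) = inj₁ (hasCyclicEmbedding-recolor H₁ χ χ′ color₁ eq e)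
  recolor {χ} {χ′} eq (inj₂ e) = inj₂ (hasCyclicEmbedding-recolor H₂ χ χ′ color₂ eq e)

  extensional : Extensional (λ (f : Fin (n ℕ.* n) → Fin 2) → Good (symmetrized f))
  extensional {f} {g} f≗g = recolor {symmetrized f} {symmetrized g}
    λ u v → cong₂ (λ i j → decodeColor i ∧ᶜ decodeColor j) (f≗g (combine u v)) (f≗g (combine v u))

-- Upper bound

length-filter-¬ : {P : Pred A ℓ} (P? : Decidable P) (xs : List A) →
  length (filter (¬? ∘ P?) xs) ℕ.+ length (filter P? xs) ≡ length xs
length-filter-¬ P? []       = refl
length-filter-¬ P? (x ∷ xs) with P? x
... | yes _ = trans (ℕ.+-suc _ _) (cong suc (length-filter-¬ P? xs))
... | no  _ = cong suc (length-filter-¬ P? xs)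

all⇒allPairs : {P : Pred A ℓ} {R : Rel A ℓ′} → (∀ {x y} → P x → P y → R x y) →
  ∀ {xs} → All P xs → AllPairs R xs
all⇒allPairs f []         = []
all⇒allPairs f (px ∷ pxs) = All.map (f px) pxs ∷ all⇒allPairs f pxs

-- A form of Mirsky's theorem, by induction on `k`. `S` records the order of the list, which
-- sublists inherit. The clause `y ∈ xs` keeps the induction going: a chain found in `others` starts
-- at an element with a predecessor in `xs`, so it can be extended downward.
chain-or-antichain : {R S : Rel A ℓ} → B.Decidable R → ∀ m k {xs} → AllPairs S xs →
  m ℕ.* k ℕ.< length xs →
  (∃[ ys ] length ys ≡ suc m × AllPairs (λ x y → S x y × ¬ R x y) ys)
  ⊎ (∃[ y ] ∃[ ys ] y ∈ xs × length ys ≡ k × Linked R (y ∷ ys))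
chain-or-antichain R? m zero {[]}     _ mk<0 = contradiction mk<0 λ ()
chain-or-antichain R? m zero {x ∷ xs} _ _    = inj₂ (x , [] , here refl , refl , [-])
chain-or-antichain {A = A} {R = R} {S} R? m (suc k) {xs} sorted mk<xs =
  split (suc m ℕ.≤? length minimal)
  where
  pred? : Decidable (λ x → Any (λ z → R z x) xs)
  pred? x = any? (λ z → R? z x) xs

  minimal others : List A
  minimal = filter (¬? ∘ pred?) xs
  others  = filter pred? xs

  incomparable : AllPairs (λ x y → S x y × ¬ R x y) minimal
  incomparable = AllPairs.zip
    ( AllPairs.filter⁺ (¬? ∘ pred?) sorted
    , all⇒allPairs (λ (x∈xs , _) (_ , ¬pred) Rxy → ¬pred (lose x∈xs Rxy))
        (All.tabulate (∈-filter⁻ (¬? ∘ pred?))))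

  mk<others : ¬ suc m ℕ.≤ length minimal → m ℕ.* k ℕ.< length others
  mk<others m≮min = ℕ.+-cancelˡ-< m _ _ (begin-strict
    m ℕ.+ m ℕ.* k                    ≡⟨ ℕ.*-suc m k ⟨
    m ℕ.* suc k                      <⟨ mk<xs ⟩
    length xs                        ≡⟨ length-filter-¬ pred? xs ⟨
    length minimal ℕ.+ length others ≤⟨ ℕ.+-monoˡ-≤ _ (ℕ.≮⇒≥ m≮min) ⟩
    m ℕ.+ length others              ∎)
    where open ℕ.≤-Reasoning

  split : Dec (suc m ℕ.≤ length minimal) → _
  split (yes m<min) = inj₁
    -- Truncated because the clique must match the order of `H` exactly.
    ( take (suc m) minimal
    , trans (length-take (suc m) minimal) (ℕ.m≤n⇒m⊓n≡m m<min)
    , AllPairs.take⁺ (suc m) incomparable)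
  split (no m≮min)
    with chain-or-antichain R? m k (AllPairs.filter⁺ pred? sorted) (mk<others m≮min)
  ... | inj₁ antichain = inj₁ antichain
  ... | inj₂ (y , ys , y∈others , refl , chain)
    with find (proj₂ (∈-filter⁻ pred? {xs = xs} y∈others))
  ...   | z , z∈xs , Rzy = inj₂ (z , y ∷ ys , z∈xs , refl , Rzy ∷ chain)

-- From lists of vertices to embeddings

lookup-AllPairs : {R : Rel A ℓ} {xs : List A} → AllPairs R xs →
  ∀ {i j} → i Fin.< j → R (lookup xs i) (lookup xs j)
lookup-AllPairs (rs ∷ _)  {zero}  {suc j} _         = All.lookup rs (∈-lookup j)
lookup-AllPairs (_ ∷ rxs) {suc i} {suc j} (s≤s i<j) = lookup-AllPairs rxs i<j

lookup-Linked : {R : Rel A ℓ} {xs : List A} → Linked R xs →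
  ∀ {i j} → suc (toℕ i) ≡ toℕ j → R (lookup xs i) (lookup xs j)
lookup-Linked (r ∷ _)   {zero}  {suc zero} _  = r
lookup-Linked (_ ∷ rxs) {suc i} {suc j}    eq = lookup-Linked rxs (ℕ.suc-injective eq)

-- The rotation at `zero` is `tabulate φ ++ []`. Symmetry of adjacency and of the coloring reduces
-- the edge condition to pairs `u < v`.
increasing⇒hasCyclicEmbedding : (H : Graph (suc h)) (χ : Coloring n) (c : Color) →
  (φ : Fin (suc h) → Fin n) → (∀ {u v} → u Fin.< v → φ u Fin.< φ v) →
  (∀ {u v} → u Fin.< v → Adj H u v → color χ (φ u) (φ v) ≡ c) →
  HasCyclicEmbedding H χ c
increasing⇒hasCyclicEmbedding H χ c φ mono edges = φ , (injective , edges′) , zero ,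
  subst (Linked Fin._<_) (sym (++-identityʳ _)) (AllPairs⇒Linked (AllPairs.tabulate⁺-< mono))
  where
  injective : Injective _≡_ _≡_ φ
  injective {u} {v} φu≡φv with Fin.<-cmp u v
  ... | tri< u<v _ _ = contradiction φu≡φv (Fin.<⇒≢ (mono u<v))
  ... | tri≈ _ u≡v _ = u≡v
  ... | tri> _ _ v<u = contradiction (sym φu≡φv) (Fin.<⇒≢ (mono v<u))

  edges′ : ∀ {u v} → Adj H u v → color χ (φ u) (φ v) ≡ c
  edges′ {u} {v} uv with Fin.<-cmp u v
  ... | tri< u<v _ _ = edges u<v uv
  ... | tri≈ _ refl _ = contradiction uv (Graph.irrefl H)
  ... | tri> _ _ v<u = trans (Coloring.color-sym χ (φ u) (φ v)) (edges v<u (Graph.sym H uv))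

clique⇒hasCyclicEmbedding : (H : Graph (suc h)) (χ : Coloring n) (c : Color) →
  ∀ xs → length xs ≡ suc h → AllPairs (λ x y → x Fin.< y × color χ x y ≡ c) xs →
  HasCyclicEmbedding H χ c
clique⇒hasCyclicEmbedding H χ c xs@(_ ∷ _) refl clique =
  increasing⇒hasCyclicEmbedding H χ c (lookup xs)
    (λ u<v → proj₁ (lookup-AllPairs clique u<v))
    (λ u<v _ → proj₂ (lookup-AllPairs clique u<v))

path⇒hasCyclicEmbedding : (χ : Coloring n) (c : Color) →
  ∀ x xs → length xs ≡ h → Linked (λ x y → x Fin.< y × color χ x y ≡ c) (x ∷ xs) →
  HasCyclicEmbedding (Pmon (suc h)) χ c
path⇒hasCyclicEmbedding χ c x xs refl path =
  increasing⇒hasCyclicEmbedding (Pmon _) χ c (lookup (x ∷ xs))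
    (lookup-AllPairs (Linked⇒AllPairs Fin.<-trans (Linked.map proj₁ path)))
    λ where
      u<v (inj₁ eq) → proj₂ (lookup-Linked path eq)
      u<v (inj₂ eq) → contradiction (ℕ.≤-reflexive eq) (ℕ.<-asym u<v)

-- Here a = `m` + 1 and b = `k` + 1. An antichain is taken in increasing order, so its pairs can
-- fail the relation only through their color.
cyclicArrow-upper : (H : Graph (suc m)) → ∀ k →
  CyclicArrow H (Pmon (suc k)) (suc (m ℕ.* k))
cyclicArrow-upper {m} H k χ
  with chain-or-antichain {R = λ x y → x Fin.< y × color χ x y ≡ color₂}
         (λ x y → (x Fin.<? y) ×-dec (color χ x y ≟ᶜ color₂)) m k
         (AllPairs.tabulate⁺-< {f = λ i → i} λ i<j → i<j)
         (ℕ.≤-reflexive (sym (length-tabulate {n = suc (m ℕ.* k)} (λ i → i))))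
... | inj₁ (xs , len , antichain) = inj₁ (clique⇒hasCyclicEmbedding H χ color₁ xs len
        (AllPairs.map (λ (x<y , ¬r) → x<y , ≢color₂⇒≡color₁ (λ eq → ¬r (x<y , eq))) antichain))
... | inj₂ (x , xs , _ , len , path) = inj₂ (path⇒hasCyclicEmbedding χ color₂ x xs len path)

-- Lower bound

Linked-++⁻ˡ : {R : Rel A ℓ} → ∀ xs {ys} → Linked R (xs ++ ys) → Linked R xs
Linked-++⁻ˡ []           _        = []
Linked-++⁻ˡ (_ ∷ [])     _        = [-]
Linked-++⁻ˡ (_ ∷ _ ∷ xs) (r ∷ rs) = r ∷ Linked-++⁻ˡ (_ ∷ xs) rs

Linked-++⁻ʳ : {R : Rel A ℓ} → ∀ xs {ys} → Linked R (xs ++ ys) → Linked R ys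
Linked-++⁻ʳ []       rs = rs
Linked-++⁻ʳ (_ ∷ xs) rs = Linked-++⁻ʳ xs (Linked.tail rs)

Linked-tabulate⁺ : {R : Rel A ℓ} {f : Fin n → A} →
  (∀ {i j} → suc (toℕ i) ≡ toℕ j → R (f i) (f j)) → Linked R (tabulate f)
Linked-tabulate⁺ {n = 0}           _ = []
Linked-tabulate⁺ {n = 1}           _ = [-]
Linked-tabulate⁺ {n = suc (suc _)} r = r refl ∷ Linked-tabulate⁺ (r ∘ cong suc)

-- Counting along one or two ascending runs

module _ (f : A → ℕ) {K : ℕ} (f<K : ∀ x → f x ℕ.< K) where

  ascent-length : ∀ x xs → Linked (ℕ._<_ on f) (x ∷ xs) → length xs ℕ.+ f x ℕ.< K
  ascent-length x []       _         = f<K x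
  ascent-length x (y ∷ xs) (lt ∷ lk) = ℕ.≤-<-trans
    (ℕ.≤-trans (ℕ.≤-reflexive (sym (ℕ.+-suc (length xs) (f x)))) (ℕ.+-monoʳ-≤ (length xs) lt))
    (ascent-length y xs lk)

  -- Each step raises `f` by at least one, except possibly the step from one run to the other. That
  -- single loss weakens the `<` of `ascent-length` to `≤`.
  ascents-length : ∀ x xs ys → Linked (ℕ._<_ on f) (x ∷ xs) → Linked (ℕ._<_ on f) ys →
    Linked (ℕ._≤_ on f) (x ∷ xs ++ ys) → length (xs ++ ys) ℕ.+ f x ℕ.≤ K
  ascents-length x []        []       _         _   _         = ℕ.<⇒≤ (f<K x)
  ascents-length x []        (y ∷ ys) _         lk  (le ∷ _)  =
    ℕ.≤-trans (s≤s (ℕ.+-monoʳ-≤ (length ys) le)) (ascent-length y ys lk)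
  ascents-length x (x′ ∷ xs) ys       (lt ∷ lk) lk′ (_ ∷ wlk) = ℕ.≤-trans
    (ℕ.≤-trans (ℕ.≤-reflexive (sym (ℕ.+-suc (length (xs ++ ys)) (f x))))
      (ℕ.+-monoʳ-≤ (length (xs ++ ys)) lt))
    (ascents-length x′ xs ys lk lk′ wlk)

  two-ascents-length : ∀ xs ys → Linked (ℕ._<_ on f) xs → Linked (ℕ._<_ on f) ys →
    Linked (ℕ._≤_ on f) (xs ++ ys) → length (xs ++ ys) ℕ.≤ suc K
  two-ascents-length []       []       _  _   _   = z≤n
  two-ascents-length []       (y ∷ ys) _  lk′ _   =
    s≤s (ℕ.≤-trans (ℕ.m≤m+n (length ys) (f y)) (ℕ.<⇒≤ (ascent-length y ys lk′)))
  two-ascents-length (x ∷ xs) ys       lk lk′ wlk =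
    s≤s (ℕ.≤-trans (ℕ.m≤m+n (length (xs ++ ys)) (f x)) (ascents-length x xs ys lk lk′ wlk))

-- The interval coloring

module _ (m : ℕ) .{{_ : NonZero m}} {n : ℕ} where

  block : Fin n → ℕ
  block v = toℕ v / m

  -- Taking the decision as argument lets symmetry be proved by cases on the two opposite decisions.
  blockColor : ∀ {x y : ℕ} → Dec (x ≡ y) → Color
  blockColor (yes _) = color₁
  blockColor (no _)  = color₂

  blockColoring : Coloring n
  blockColoring = record
    { color     = λ u v → blockColor (block u ℕ.≟ block v)
    ; color-sym = λ u v → blockColor-sym (block u ℕ.≟ block v) (block v ℕ.≟ block u)
    }
    where
    blockColor-sym : ∀ {x y} (d : Dec (x ≡ y)) (d′ : Dec (y ≡ x)) → blockColor d ≡ blockColor d′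
    blockColor-sym (yes _)  (yes _)  = refl
    blockColor-sym (yes eq) (no neq) = contradiction (sym eq) neq
    blockColor-sym (no neq) (yes eq) = contradiction (sym eq) neq
    blockColor-sym (no _)   (no _)   = refl

  color₁⇒≡block : ∀ {u v} → color blockColoring u v ≡ color₁ → block u ≡ block v
  color₁⇒≡block {u} {v} eq with block u ℕ.≟ block v
  ... | yes b≡b = b≡b
  ... | no _    = contradiction eq λ ()

  color₂⇒≢block : ∀ {u v} → color blockColoring u v ≡ color₂ → block u ≢ block v
  color₂⇒≢block {u} {v} eq with block u ℕ.≟ block v
  ... | yes _   = contradiction eq λ ()
  ... | no b≢b  = b≢b

  -- Walks keep the image inside one block. Two of the `m` + 1 vertices have images with the same
  -- remainder modulo `m`; as the quotients agree too, these images coincide, against injectivity.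
  ¬connected-in-block : (H : Graph (suc m)) → Connected H →
    ¬ HasCyclicEmbedding H blockColoring color₁
  ¬connected-in-block H conn (φ , (inj , edges) , _) =
    let i , j , i<j , ri≡rj = Fin.pigeonhole (ℕ.n<1+n m) (λ u → toℕ (φ u) mod m)
    in Fin.<⇒≢ i<j (inj (Fin.toℕ-injective (begin
         toℕ (φ i)
           ≡⟨ m≡m%n+[m/n]*n (toℕ (φ i)) m ⟩
         toℕ (φ i) % m ℕ.+ block (φ i) ℕ.* m
           ≡⟨ cong₂ (λ r q → r ℕ.+ q ℕ.* m) (rem≡ ri≡rj) (same-block (conn i j)) ⟩
         toℕ (φ j) % m ℕ.+ block (φ j) ℕ.* m
           ≡⟨ m≡m%n+[m/n]*n (toℕ (φ j)) m ⟨
         toℕ (φ j) ∎)))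
    where
    open ≡-Reasoning

    same-block : ∀ {u v} → Star (Adj H) u v → block (φ u) ≡ block (φ v)
    same-block ε         = refl
    same-block (uw ◅ wv) = trans (color₁⇒≡block (edges uw)) (same-block wv)

    rem≡ : ∀ {x y} → x mod m ≡ y mod m → x % m ≡ y % m
    rem≡ eq = trans (sym (Fin.toℕ-fromℕ< _)) (trans (cong toℕ eq) (Fin.toℕ-fromℕ< _))

  ¬path-across-blocks : ∀ k → n ℕ.≤ m ℕ.* k →
    ¬ HasCyclicEmbedding (Pmon (suc (suc k))) blockColoring color₂
  ¬path-across-blocks k n≤mk (φ , (_ , edges) , t , increasing) =
    -- The path has `k` + 2 vertices, while two runs through `k` blocks have at most `k` + 1.
    ℕ.1+n≰n (ℕ.≤-trans (ℕ.≤-reflexive (sym length-rotated))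
      (two-ascents-length block block<k D T
        (ascent D (Linked-++⁻ˡ D increasing) (Linked-++⁻ʳ T steps))
        (ascent T (Linked-++⁻ʳ D increasing) (Linked-++⁻ˡ T steps))
        (Linked.map block-mono increasing)))
    where
    T D : List (Fin n)
    T = take (toℕ t) (tabulate φ)
    D = drop (toℕ t) (tabulate φ)

    length-rotated : length (D ++ T) ≡ suc (suc k)
    length-rotated = trans (length-++-comm D T)
      (trans (cong length (take++drop≡id (toℕ t) (tabulate φ))) (length-tabulate φ))

    -- Path order is `T ++ D`, increasing order is `D ++ T`. They share the consecutive pairs within
    -- `D` and within `T`, so the blocks rise strictly there; from `D` to `T` they may stay equal.
    steps : Linked (λ u v → block u ≢ block v) (T ++ D)
    steps = subst (Linked _) (sym (take++drop≡id (toℕ t) (tabulate φ)))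
      (Linked-tabulate⁺ λ eq → color₂⇒≢block (edges (inj₁ eq)))

    block<k : ∀ v → block v ℕ.< k
    block<k v = m<n*o⇒m/o<n
      (ℕ.<-≤-trans (Fin.toℕ<n v) (ℕ.≤-trans n≤mk (ℕ.≤-reflexive (ℕ.*-comm m k))))

    block-mono : ∀ {u v} → u Fin.< v → block u ℕ.≤ block v
    block-mono u<v = /-monoˡ-≤ m (ℕ.<⇒≤ u<v)

    ascent : ∀ xs → Linked Fin._<_ xs → Linked (λ u v → block u ≢ block v) xs →
      Linked (ℕ._<_ on block) xs
    ascent xs lk lk′ = Linked.zipWith (λ (u<v , b≢b) → ℕ.≤∧≢⇒< (block-mono u<v) b≢b) (lk , lk′)

-- Settles the lower bound in the degenerate cases a = 1 (blocks of size 0) and b = 1 (a negative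
-- number of blocks).
cyclicArrow⇒positive : (H₁ : Graph h₁) (H₂ : Graph h₂) → ∀ {n} → CyclicArrow H₁ H₂ n → 1 ℕ.≤ n
cyclicArrow⇒positive H₁ H₂ {suc n} _     = s≤s z≤n
cyclicArrow⇒positive H₁ H₂ {zero}  arrow
  with arrow (record { color = λ () ; color-sym = λ () })
... | inj₁ (φ , _ , t , _) = contradiction (φ t) λ ()
... | inj₂ (φ , _ , t , _) = contradiction (φ t) λ ()

cyclicArrow-lower : (H : Graph (suc m)) → Connected H → ∀ k {n} →
  CyclicArrow H (Pmon (suc (suc k))) n → m ℕ.* k ℕ.< n
-- With `m` = 0 the product `m * k` computes to 0.
cyclicArrow-lower {zero}      H conn k arrow = cyclicArrow⇒positive H (Pmon (suc (suc k))) arrow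
cyclicArrow-lower {m@(suc _)} H conn k arrow =
  ℕ.≰⇒> λ n≤mk → impossible n≤mk (arrow (blockColoring m))
  where
  impossible : ∀ {n} → n ℕ.≤ m ℕ.* k →
    ¬ (HasCyclicEmbedding H (blockColoring m {n}) color₁
      ⊎ HasCyclicEmbedding (Pmon (suc (suc k))) (blockColoring m {n}) color₂)
  impossible _    (inj₁ e) = ¬connected-in-block m H conn e
  impossible n≤mk (inj₂ e) = ¬path-across-blocks m k n≤mk e

theorem4p5 : (a : ℕ) → 1 ℕ.≤ a → (H : Graph a) → Connected H →
    (b : ℕ) → 1 ℕ.≤ b →
    ∃[ R ] (IsRcyc H (Pmon b) R
    × + 1 + (+ a - + 1) * (+ b - + 2) ≤ + R
    × + R ≤ + 1 + (+ a - + 1) * (+ b - + 1))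
theorem4p5 (suc m) _ H conn (suc k) _
  with least (cyclicArrow? H (Pmon (suc k))) (suc (m ℕ.* k)) (cyclicArrow-upper H k)
... | R , arrow , minimal = R , (arrow , minimal) , lower k arrow , upper
  where
  upper : + R ≤ + 1 + + m * + k
  upper = subst (λ i → + R ≤ + 1 + i) (ℤ.pos-* m k) (+≤+ (minimal _ (cyclicArrow-upper H k)))

  lower : ∀ k → CyclicArrow H (Pmon (suc k)) R → + 1 + + m * (+ suc k - + 2) ≤ + R
  -- For b = `k` + 2 the factor b - 2 computes to `+ k`.
  lower (suc k) arr = subst (λ i → + 1 + i ≤ + R) (ℤ.pos-* m k) (+≤+ (cyclicArrow-lower H conn k arr))
  -- For b = 1 the factor b - 2 is -1, so the product is at most 0 and `R` ≥ 1 suffices.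
  lower zero    arr = ℤ.≤-trans
    (ℤ.+-monoʳ-≤ (+ 1) (ℤ.≤-trans (ℤ.*-monoˡ-≤-nonNeg (+ m) -≤+) (ℤ.≤-reflexive (ℤ.*-zeroʳ (+ m)))))
    (+≤+ (cyclicArrow⇒positive H (Pmon 1) arr))
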